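{- The diagonals and columns of $F$ are periodic: for every integer $a\ge 0$ and every integer $n>a$, $F_{n+2a+1,\,n+a+1}=F_{n,n-a}$ (the $a$-th subdiagonal $(F_{n,n-a})_{n>a}$ has period $2a+1$); and for every integer $a\ge 1$ and every integer $n\ge a$, $F_{n+a,a}=F_{n,a}$ (the $a$-th column $(F_{n,a})_{n\ge a}$ has period $a$).
   Context: Define maps $G,S:\mathbb Z^2\to\mathbb Z^2$ by $G(x,y)=(x+y,y)$ and $S(x,y)=(3x-2y+1,\,2x-y+1)$. Define the array $(F_{n,k})_{n,k\ge 0}$ by $F_{0,0}=1$ and, for $(n,k)\neq(0,0)$, $F_{n,k}$ is the number of finite words $w=w_1w_2\cdots w_m$ ($m\ge 0$) over the alphabet $\{G,S\}$ with $w_1\circ w_2\circ\cdots\circ w_m(1,1)=(n,k)$ (the empty word acts as the identity). Equivalently: start with all entries $0$, set $F_{0,0}=1$ and $F_{1,1}=1$, and thereafter, whenever an entry $F_{n,k}$ with $n\ge 1$ changes its value, increase $F_{n+k,k}$ and $F_{3n+1-2k,\,2n+1-k}$ by $1$. -}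

module Defs where

open import Data.Empty using (⊥-elim)
open import Data.Fin using (Fin)
open import Data.Fin.Properties using (0↔⊥; 1↔⊤; +↔⊎)
open import Data.Integer as ℤ using (ℤ; +_; 1ℤ)
import Data.Integer.Properties as ℤ
import Data.Integer.Tactic.RingSolver as ℤ-Solver
open import Data.List using (List; []; _∷_; length)
open import Data.Nat using (ℕ; zero; suc; _≤_; z≤n; s≤s; _+_)
import Data.Nat.Properties as ℕ
import Data.Nat.Tactic.RingSolver as ℕ-Solver
open import Data.Product using (Σ; ∃; ∃₂; _×_; _,_; proj₁; proj₂)
open import Data.Product.Properties using (≡-dec; ,-injectiveˡ)
open import Data.Sum using (_⊎_; inj₁; inj₂)
open import Data.Sum.Function.Propositional using (_⊎-↔_)
open import Data.Unit using (tt)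
open import Function using (_∘_; id)
open import Function.Bundles using (_↔_; mk↔ₛ′)
open import Function.Construct.Composition using (_↔-∘_)
open import Relation.Binary.PropositionalEquality
open import Relation.Binary.PropositionalEquality.WithK using (≡-irrelevant)
open import Relation.Nullary using (Dec; yes; no; Irrelevant)
import Relation.Unary as U

data Letter : Set where
  G S : Letter

Word : Set
Word = List Letter

⟦_⟧ : Letter → ℤ × ℤ → ℤ × ℤ
⟦ G ⟧ (x , y) = x ℤ.+ y , y
⟦ S ⟧ (x , y) = + 3 ℤ.* x ℤ.- + 2 ℤ.* y ℤ.+ 1ℤ , + 2 ℤ.* x ℤ.- y ℤ.+ 1ℤ

-- The first letter of a word is the map applied last.
⟦_⟧* : Word → ℤ × ℤ → ℤ × ℤ
⟦ [] ⟧*    = id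
⟦ l ∷ w ⟧* = ⟦ l ⟧ ∘ ⟦ w ⟧*

WordTo : ℕ → ℕ → Word → Set
WordTo n k w = ⟦ w ⟧* (1ℤ , 1ℤ) ≡ (+ n , + k)

WordsTo : ℕ → ℕ → Set
WordsTo n k = Σ Word (WordTo n k)

Finite : Set → Set
Finite A = ∃ λ c → Fin c ↔ A

private
  dec-finite : {P : Set} → Irrelevant P → Dec P → Finite P
  dec-finite irr (yes p) =
    1 , mk↔ₛ′ (λ _ → p) (λ _ → tt) (irr p) (λ _ → refl) ↔-∘ 1↔⊤
  dec-finite irr (no ¬p) =
    0 , mk↔ₛ′ ⊥-elim (λ p → ¬p p) (λ p → ⊥-elim (¬p p)) (λ ()) ↔-∘ 0↔⊥

  ⊎-finite : {A B : Set} → Finite A → Finite B → Finite (A ⊎ B)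
  ⊎-finite (a , f) (b , g) = a + b , (f ⊎-↔ g) ↔-∘ +↔⊎

  split : (P : Word → Set) →
          (P [] ⊎ Σ Word (P ∘ (G ∷_)) ⊎ Σ Word (P ∘ (S ∷_))) ↔ Σ Word P
  split P = mk↔ₛ′ to from to∘from from∘to
    where
    to : P [] ⊎ Σ Word (P ∘ (G ∷_)) ⊎ Σ Word (P ∘ (S ∷_)) → Σ Word P
    to (inj₁ p)              = [] , p
    to (inj₂ (inj₁ (w , p))) = G ∷ w , p
    to (inj₂ (inj₂ (w , p))) = S ∷ w , p
    from : Σ Word P → P [] ⊎ Σ Word (P ∘ (G ∷_)) ⊎ Σ Word (P ∘ (S ∷_))
    from ([] , p)    = inj₁ p
    from (G ∷ w , p) = inj₂ (inj₁ (w , p))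
    from (S ∷ w , p) = inj₂ (inj₂ (w , p))
    to∘from : ∀ x → to (from x) ≡ x
    to∘from ([] , _)    = refl
    to∘from (G ∷ _ , _) = refl
    to∘from (S ∷ _ , _) = refl
    from∘to : ∀ x → from (to x) ≡ x
    from∘to (inj₁ _)        = refl
    from∘to (inj₂ (inj₁ _)) = refl
    from∘to (inj₂ (inj₂ _)) = refl

  bounded-finite : (m : ℕ) {P : Word → Set} → U.Decidable P → U.Irrelevant P →
                   (∀ w → P w → length w ≤ m) → Finite (Σ Word P)
  bounded-finite zero {P} P? irr bd =
    let c , f = dec-finite irr (P? [])
    in  c , mk↔ₛ′ ([] ,_) from to∘from (λ _ → refl) ↔-∘ f
    where
    from : Σ Word P → P []
    from ([] , p)    = p
    from (l ∷ w , p) with () ← bd (l ∷ w) p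
    to∘from : ∀ x → ([] , from x) ≡ x
    to∘from ([] , p)    = refl
    to∘from (l ∷ w , p) with () ← bd (l ∷ w) p
  bounded-finite (suc m) {P} P? irr bd =
    let c , f = ⊎-finite (dec-finite irr (P? []))
                  (⊎-finite (bounded-finite m (P? ∘ (G ∷_)) irr (bd′ G))
                            (bounded-finite m (P? ∘ (S ∷_)) irr (bd′ S)))
    in  c , split P ↔-∘ f
    where
    bd′ : ∀ l w → P (l ∷ w) → length w ≤ m
    bd′ l w p = ℕ.≤-pred (bd (l ∷ w) p)

  pos-S₁ : ∀ a b → + 3 ℤ.* (1ℤ ℤ.+ b ℤ.+ a) ℤ.- + 2 ℤ.* (1ℤ ℤ.+ b) ℤ.+ 1ℤ
                   ≡ 1ℤ ℤ.+ (b ℤ.+ (a ℤ.+ a) ℤ.+ 1ℤ) ℤ.+ a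
  pos-S₁ = ℤ-Solver.solve-∀

  pos-S₂ : ∀ a b → + 2 ℤ.* (1ℤ ℤ.+ b ℤ.+ a) ℤ.- (1ℤ ℤ.+ b) ℤ.+ 1ℤ
                   ≡ 1ℤ ℤ.+ (b ℤ.+ (a ℤ.+ a) ℤ.+ 1ℤ)
  pos-S₂ = ℤ-Solver.solve-∀

  -- Every reachable point is (1 + b + a , 1 + b) with a, b ≥ 0, and each letter
  -- increases a + b.
  reachable : ∀ w → ∃₂ λ a b →
    ⟦ w ⟧* (1ℤ , 1ℤ) ≡ (+ (1 + b + a) , + (1 + b)) × length w ≤ a + b
  reachable [] = 0 , 0 , refl , z≤n
  reachable (G ∷ w) with a , b , eq , le ← reachable w =
    a + suc b , b
    , trans (cong ⟦ G ⟧ eq) (cong (λ x → + x , + suc b) (ℕ.+-assoc (suc b) a (suc b)))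
    , (begin
        suc (length w)   ≤⟨ s≤s le ⟩
        suc (a + b)      ≡⟨ ℕ.+-suc a b ⟨
        a + suc b        ≤⟨ ℕ.m≤m+n _ b ⟩
        a + suc b + b    ∎)
    where open ℕ.≤-Reasoning
  reachable (S ∷ w) with a , b , eq , le ← reachable w =
    a , b + (a + a) + 1
    , trans (cong ⟦ S ⟧ eq) (cong₂ _,_ (pos-S₁ (+ a) (+ b)) (pos-S₂ (+ a) (+ b)))
    , (begin
        suc (length w)             ≤⟨ s≤s le ⟩
        suc (a + b)                ≤⟨ ℕ.m≤m+n _ (a + a) ⟩
        suc (a + b) + (a + a)      ≡⟨ rearrange a b ⟩
        a + (b + (a + a) + 1)      ∎)
    where
    open ℕ.≤-Reasoning
    rearrange : ∀ a b → suc (a + b) + (a + a) ≡ a + (b + (a + a) + 1)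
    rearrange = ℕ-Solver.solve-∀

  length-bound : ∀ n k w → WordTo n k w → length w ≤ n
  length-bound n k w p with a , b , eq , le ← reachable w = begin
    length w     ≤⟨ le ⟩
    a + b        ≡⟨ ℕ.+-comm a b ⟩
    b + a        ≤⟨ ℕ.n≤1+n _ ⟩
    1 + b + a    ≡⟨ ℤ.+-injective (,-injectiveˡ (trans (sym eq) p)) ⟩
    n            ∎
    where open ℕ.≤-Reasoning

WordsTo-finite : ∀ n k → Finite (WordsTo n k)
WordsTo-finite n k =
  bounded-finite n (λ w → ≡-dec ℤ._≟_ ℤ._≟_ (⟦ w ⟧* (1ℤ , 1ℤ)) (+ n , + k))
    ≡-irrelevant (length-bound n k)

F : ℕ → ℕ → ℕ
F zero    zero    = 1
F zero    (suc k) = proj₁ (WordsTo-finite zero (suc k))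
F (suc n) k       = proj₁ (WordsTo-finite (suc n) k)

F-counts : ∀ n k → (n , k) ≢ (0 , 0) → Fin (F n k) ↔ WordsTo n k
F-counts zero    zero    ≢0 = ⊥-elim (≢0 refl)
F-counts zero    (suc k) _  = proj₂ (WordsTo-finite zero (suc k))
F-counts (suc n) k       _  = proj₂ (WordsTo-finite (suc n) k)

{-# OPTIONS --safe #-}
-- In the coordinates (a , b) = (n - k , k - 1), the letters act on ℕ × ℕ by
-- G (a , b) = (a + b + 1 , b) and S (a , b) = (a , b + 2 a + 1).  Both maps are
-- injective and avoid (0 , 0), and their images are disjoint: a < b on the image
-- of S, and b < a on that of G.  So the words leading to G p (respectively S p)
-- are exactly those leading to p, with a letter G (respectively S) put in front.
module Submission where

open import Defs
open import Data.Empty using (⊥-elim)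
open import Data.Fin using (Fin)
open import Data.Fin.Permutation using (↔⇒≡)
open import Data.Integer as ℤ using (ℤ; +_; 1ℤ)
import Data.Integer.Properties as ℤ
import Data.Integer.Tactic.RingSolver as ℤ-Solver
open import Data.List using ([]; _∷_; foldr)
open import Data.Nat using (ℕ; suc; _+_; _*_; _∸_; _<_; _>_; _≥_; s≤s)
import Data.Nat.Properties as ℕ
import Data.Nat.Tactic.RingSolver as ℕ-Solver
open import Data.Product using (Σ; ∃; _×_; _,_; proj₁; proj₂)
open import Data.Product.Properties using (,-injectiveˡ; ,-injectiveʳ)
open import Function.Bundles using (_↔_; mk↔ₛ′)
open import Function.Construct.Composition using (_↔-∘_)
open import Function.Construct.Symmetry using (↔-sym)
open import Relation.Binary.PropositionalEquality
open import Relation.Binary.PropositionalEquality.WithK using (≡-irrelevant)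

step : Letter → ℕ × ℕ → ℕ × ℕ
step G (a , b) = a + suc b , b
step S (a , b) = a , b + suc (a + a)

position : Word → ℕ × ℕ
position = foldr step (0 , 0)

point : ℕ × ℕ → ℤ × ℤ
point (a , b) = + (1 + b + a) , + (1 + b)

point-injective : ∀ {p q} → point p ≡ point q → p ≡ q
point-injective {_ , b} eq
  with refl ← ℕ.suc-injective (ℤ.+-injective (,-injectiveʳ eq)) =
  cong (_, b) (ℕ.+-cancelˡ-≡ (suc b) _ _ (ℤ.+-injective (,-injectiveˡ eq)))

-- For `G` everything computes in ℕ up to associativity. For `S` the subtractions cancel by ring
-- identities over ℤ, whose right-hand sides reduce to `point (step S (a , b))` at `+ a` and `+ b`.
⟦⟧-point : ∀ l p → ⟦ l ⟧ (point p) ≡ point (step l p)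
⟦⟧-point G (a , b) = cong (λ x → + x , + suc b) (ℕ.+-assoc (suc b) a (suc b))
⟦⟧-point S (a , b) = cong₂ _,_ (first (+ a) (+ b)) (second (+ a) (+ b))
  where
  first : ∀ a b → + 3 ℤ.* (1ℤ ℤ.+ b ℤ.+ a) ℤ.- + 2 ℤ.* (1ℤ ℤ.+ b) ℤ.+ 1ℤ
                  ≡ 1ℤ ℤ.+ (b ℤ.+ (1ℤ ℤ.+ (a ℤ.+ a))) ℤ.+ a
  first = ℤ-Solver.solve-∀
  second : ∀ a b → + 2 ℤ.* (1ℤ ℤ.+ b ℤ.+ a) ℤ.- (1ℤ ℤ.+ b) ℤ.+ 1ℤ
                   ≡ 1ℤ ℤ.+ (b ℤ.+ (1ℤ ℤ.+ (a ℤ.+ a)))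
  second = ℤ-Solver.solve-∀

⟦⟧*-position : ∀ w → ⟦ w ⟧* (1ℤ , 1ℤ) ≡ point (position w)
⟦⟧*-position []      = refl
⟦⟧*-position (l ∷ w) = trans (cong ⟦ l ⟧ (⟦⟧*-position w)) (⟦⟧-point l (position w))

step≢start : ∀ l p → (0 , 0) ≢ step l p
step≢start G (a , b) eq = ℕ.m+1+n≢0 a (sym (,-injectiveˡ eq))
step≢start S (a , b) eq = ℕ.m+1+n≢0 b (sym (,-injectiveʳ eq))

G-image : ∀ p → proj₂ (step G p) < proj₁ (step G p)
G-image (a , b) = ℕ.m≤n+m (suc b) a

S-image : ∀ p → proj₁ (step S p) < proj₂ (step S p)
S-image (a , b) = ℕ.≤-trans (s≤s (ℕ.m≤m+n a a)) (ℕ.m≤n+m (suc (a + a)) b)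

step-G≢step-S : ∀ p q → step G p ≢ step S q
step-G≢step-S p q eq =
  ℕ.<-asym (G-image p) (subst (λ (a , b) → a < b) (sym eq) (S-image q))

-- Comparing the two coordinates reveals the letter. The coordinate which that letter fixes
-- determines the increment of the other, and the increment cancels.
step-injective : ∀ l m {p q} → step l p ≡ step m q → l ≡ m × p ≡ q
step-injective G G {_ , b} eq with refl ← ,-injectiveʳ eq =
  refl , cong (_, b) (ℕ.+-cancelʳ-≡ (suc b) _ _ (,-injectiveˡ eq))
step-injective S S {a , _} eq with refl ← ,-injectiveˡ eq =
  refl , cong (a ,_) (ℕ.+-cancelʳ-≡ (suc (a + a)) _ _ (,-injectiveʳ eq))
step-injective G S eq = ⊥-elim (step-G≢step-S _ _ eq)
step-injective S G eq = ⊥-elim (step-G≢step-S _ _ (sym eq))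

WordsAt : ℕ × ℕ → Set
WordsAt p = Σ Word λ w → position w ≡ p

-- The equation `l ∷ w′ ≡ w` is kept in the result because both inverse laws of `WordsAt-step` rest
-- on it.
uncons : ∀ l p w → position w ≡ step l p →
         ∃ λ w′ → l ∷ w′ ≡ w × position w′ ≡ p
uncons l p []      eq = ⊥-elim (step≢start l p eq)
uncons l p (m ∷ w) eq with refl , eq′ ← step-injective m l eq = w , refl , eq′

-- Identity proofs are unique, so inverse laws need only compare words.
WordsAt-≡ : ∀ {p} {x y : WordsAt p} → proj₁ x ≡ proj₁ y → x ≡ y
WordsAt-≡ {x = w , e} {y = .w , e′} refl = cong (w ,_) (≡-irrelevant e e′)

WordsAt-step : ∀ l p → WordsAt p ↔ WordsAt (step l p)
WordsAt-step l p = mk↔ₛ′ to from to∘from from∘to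
  where
  to : WordsAt p → WordsAt (step l p)
  to (w , e) = l ∷ w , cong (step l) e
  from : WordsAt (step l p) → WordsAt p
  from (w , e) = let w′ , _ , e′ = uncons l p w e in w′ , e′
  to∘from : ∀ x → to (from x) ≡ x
  to∘from (w , e) = WordsAt-≡ (proj₁ (proj₂ (uncons l p w e)))
  from∘to : ∀ x → from (to x) ≡ x
  from∘to (w , e) with w′ , refl , _ ← uncons l p (l ∷ w) (cong (step l) e) =
    WordsAt-≡ refl

F-at : ℕ × ℕ → ℕ
F-at (a , b) = F (1 + b + a) (1 + b)

F-at-counts : ∀ p → Fin (F-at p) ↔ WordsAt p
F-at-counts p@(a , b) = mk↔ₛ′ to from (λ _ → WordsAt-≡ refl) from∘to
                        -- Both indices are successors, so the exceptional entry `F 0 0` is never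
                        -- met.
                        ↔-∘ F-counts (1 + b + a) (1 + b) (λ ())
  where
  to : WordsTo (1 + b + a) (1 + b) → WordsAt p
  to (w , e) = w , point-injective (trans (sym (⟦⟧*-position w)) e)
  from : WordsAt p → WordsTo (1 + b + a) (1 + b)
  from (w , e) = w , trans (⟦⟧*-position w) (cong point e)
  from∘to : ∀ x → from (to x) ≡ x
  from∘to (w , e) = cong (w ,_) (≡-irrelevant _ e)

-- Finite sets in bijection have equal size. Taking `S` for `l` gives the diagonals, `G` the
-- columns.
F-at-step : ∀ l p → F-at (step l p) ≡ F-at p
F-at-step l p = sym (↔⇒≡ (↔-sym (F-at-counts (step l p)) ↔-∘
                    (WordsAt-step l p ↔-∘ F-at-counts p)))

theorem13 : ((a n : ℕ) → n > a → F (n + 2 * a + 1) (n + a + 1) ≡ F n (n ∸ a))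
    × ((a n : ℕ) → a ≥ 1 → n ≥ a → F (n + a) a ≡ F n a)
theorem13 = diagonal , column
  where
  row : ∀ a b → suc (a + b) + 2 * a + 1 ≡ 1 + (b + suc (a + a)) + a
  row = ℕ-Solver.solve-∀
  col : ∀ a b → suc (a + b) + a + 1 ≡ 1 + (b + suc (a + a))
  col = ℕ-Solver.solve-∀

  diagonal : (a n : ℕ) → n > a → F (n + 2 * a + 1) (n + a + 1) ≡ F n (n ∸ a)
  -- Here `n` is `suc a + b`, so the entry `(n , n ∸ a)` has coordinates `(a , b)`; `S` keeps `a`
  -- and adds the period to `b`.
  diagonal a n n>a with b , refl ← ℕ.m≤n⇒∃[o]m+o≡n n>a = begin
    F (suc (a + b) + 2 * a + 1) (suc (a + b) + a + 1)  ≡⟨ cong₂ F (row a b) (col a b) ⟩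
    F-at (step S (a , b))                              ≡⟨ F-at-step S (a , b) ⟩
    F (suc b + a) (suc b)                              ≡⟨ cong₂ F n≡ (sym k≡) ⟩
    F (suc (a + b)) (suc (a + b) ∸ a)                  ∎
    where
    open ≡-Reasoning
    n≡ : suc b + a ≡ suc (a + b)
    n≡ = cong suc (ℕ.+-comm b a)
    k≡ : suc (a + b) ∸ a ≡ suc b
    k≡ = trans (cong (_∸ a) (sym n≡)) (ℕ.m+n∸n≡m (suc b) a)

  column : (a n : ℕ) → a ≥ 1 → n ≥ a → F (n + a) a ≡ F n a
  -- Column `suc b` consists of the points `(c , b)`, and `G` adds `suc b`, the period, to `c`.
  column (suc b) n _ n≥a with c , refl ← ℕ.m≤n⇒∃[o]m+o≡n n≥a =
    trans (cong (λ x → F x (suc b)) (ℕ.+-assoc (suc b) c (suc b)))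
          (F-at-step G (c , b))
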